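{- If $n > k \geq s \geq 0$ are integers, then there exists no $(n,k,s,s)$-oriented graph.
   Context: An oriented graph is a digraph with no loops and no pair of symmetric arcs. For vertices $u,v$ write $u(1\text{ - }0)v$ if there is an arc from $u$ to $v$, and $u(0\text{ - }0)v$ if there is no arc between $u$ and $v$. A vertex $v$ is weakly reachable within two steps from $u$ if $u(1\text{ - }0)v$, or $u(0\text{ - }0)v$, or for some vertex $w$ one has $u(1\text{ - }0)w(1\text{ - }0)v$, or $u(1\text{ - }0)w(0\text{ - }0)v$, or $u(0\text{ - }0)w(1\text{ - }0)v$. A vertex $u$ is a weak king if every other vertex is weakly reachable within two steps from $u$, and a weak serf if $u$ is weakly reachable within two steps from every other vertex. An $(n,k,s,b)$-oriented graph is an oriented graph on $n$ vertices with exactly $k$ weak kings and exactly $s$ weak serfs, such that exactly $b$ of the weak kings are also weak serfs. -}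

module Defs where

open import Data.Fin using (Fin; _≟_)
open import Data.Fin.Properties using (any?; all?)
open import Data.List using (length; filter; allFin)
open import Data.Nat using (ℕ)
open import Data.Product using (_×_; ∃-syntax)
open import Data.Sum using (_⊎_)
open import Level using (0ℓ)
open import Relation.Binary.Core using (Rel)
open import Relation.Binary.Definitions using (Decidable; Irreflexive; Asymmetric)
open import Relation.Binary.PropositionalEquality using (_≡_; _≢_)
open import Relation.Nullary using (¬_; ¬?; _×-dec_; _⊎-dec_; _→-dec_)
open import Relation.Unary using (Pred) renaming (Decidable to Decidable₁)
open import Relation.Unary.Properties using (_∩?_)

-- u ⟶ v is the paper's u(1-0)v.  Arcs are decidable because the graph is
-- finite, so that the kings and serfs can be counted.
record OrientedGraph (n : ℕ) : Set₁ where
  infix 4 _⟶_ _⟶?_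
  field
    _⟶_    : Rel (Fin n) 0ℓ
    _⟶?_   : Decidable _⟶_
    irrefl : Irreflexive _≡_ _⟶_
    asym   : Asymmetric _⟶_

cardinality : ∀ {n} {P : Pred (Fin n) 0ℓ} → Decidable₁ P → ℕ
cardinality {n} P? = length (filter P? (allFin n))

module _ {n : ℕ} (G : OrientedGraph n) where
  open OrientedGraph G

  -- u(0-0)v
  NoArc : Rel (Fin n) 0ℓ
  NoArc u v = ¬ (u ⟶ v) × ¬ (v ⟶ u)

  noArc? : Decidable NoArc
  noArc? u v = ¬? (u ⟶? v) ×-dec ¬? (v ⟶? u)

  -- WeaklyReachable u v: v is weakly reachable within two steps from u.
  WeaklyReachable : Rel (Fin n) 0ℓ
  WeaklyReachable u v =
    u ⟶ v ⊎
    NoArc u v ⊎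
    (∃[ w ] ((u ⟶ w × w ⟶ v) ⊎ (u ⟶ w × NoArc w v) ⊎ (NoArc u w × w ⟶ v)))

  weaklyReachable? : Decidable WeaklyReachable
  weaklyReachable? u v =
    (u ⟶? v) ⊎-dec
    noArc? u v ⊎-dec
    any? (λ w → ((u ⟶? w) ×-dec (w ⟶? v)) ⊎-dec
                ((u ⟶? w) ×-dec noArc? w v) ⊎-dec
                (noArc? u w ×-dec (w ⟶? v)))

  WeakKing : Pred (Fin n) 0ℓ
  WeakKing u = ∀ v → v ≢ u → WeaklyReachable u v

  weakKing? : Decidable₁ WeakKing
  weakKing? u = all? (λ v → ¬? (v ≟ u) →-dec weaklyReachable? u v)

  WeakSerf : Pred (Fin n) 0ℓ
  WeakSerf u = ∀ v → v ≢ u → WeaklyReachable v u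

  weakSerf? : Decidable₁ WeakSerf
  weakSerf? u = all? (λ v → ¬? (v ≟ u) →-dec weaklyReachable? v u)

-- An (n,k,s,b)-oriented graph.
record KingSerfGraph (n k s b : ℕ) : Set₁ where
  field
    graph     : OrientedGraph n
    kings     : cardinality (weakKing? graph) ≡ k
    serfs     : cardinality (weakSerf? graph) ≡ s
    kingSerfs : cardinality (weakKing? graph ∩? weakSerf? graph) ≡ b

{-# OPTIONS --safe #-}

-- The failure of weak reachability is a strict partial order: u is not weakly
-- reachable from v exactly when u covers v in the sense of McKelvey.  A weak
-- king is thus an uncovered vertex, and a weak serf one that covers nothing.
-- If some vertex is covered, descend from it along covers to a vertex that
-- covers nothing; it is still covered, so it is a weak serf but no weak king.
-- The counts forbid this: they make every weak serf a weak king.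

module Submission where

open import Defs
open import Data.Fin using (Fin)
open import Data.Fin.Induction using (spo-noetherian)
open import Data.Fin.Properties using (any?; ¬∀⟶∃¬)
open import Data.List using (List; length; filter; allFin)
open import Data.List.Membership.Propositional using (_∈_)
open import Data.List.Membership.Propositional.Properties using (∈-allFin; ∈-filter⁺; ∈-filter⁻)
open import Data.List.Properties using (filter-all; length-tabulate)
open import Data.List.Relation.Binary.Pointwise using (Pointwise-≡⇒≡)
open import Data.List.Relation.Binary.Sublist.Heterogeneous.Properties using (toPointwise)
open import Data.List.Relation.Binary.Sublist.Propositional using (⊆-refl)
open import Data.List.Relation.Binary.Sublist.Propositional.Properties using (filter⁺)
open import Data.List.Relation.Unary.All.Properties using (tabulate⁺)
open import Data.Nat using (ℕ; _>_; _≥_; _<_)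
open import Data.Nat.Properties using (<⇒≢)
open import Data.Product using (_×_; _,_; ∃-syntax; proj₁; proj₂)
open import Data.Sum using (inj₁; inj₂)
open import Function using (_∘_; _⇔_; id; flip; mk⇔)
open import Induction.WellFounded using (Acc; acc; WellFounded)
open import Level using (Level; 0ℓ)
open import Relation.Binary.Core using (Rel)
open import Relation.Binary.Definitions using (Decidable; Irreflexive; Transitive; _Respects_)
open import Relation.Binary.PropositionalEquality
  using (_≡_; refl; sym; trans; cong; subst; isEquivalence; resp₂; module ≡-Reasoning)
open import Relation.Binary.Structures using (IsStrictPartialOrder)
open import Relation.Nullary using (¬_; ¬?; Dec; yes; no; decidable-stable)
open import Relation.Nullary.Decidable using () renaming (map to map-dec)
open import Relation.Unary using (Pred; _⊆_; Empty; Satisfiable) renaming (Decidable to Decidable₁)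
open import Relation.Unary.Properties using (_∩?_)

private
  variable
    a ℓ p q : Level
    A : Set a
    n : ℕ

⊆∧length-filter-≡⇒filter-≡ : {P : Pred A p} {Q : Pred A q} (P? : Decidable₁ P) (Q? : Decidable₁ Q) →
                             P ⊆ Q → (xs : List A) →
                             length (filter P? xs) ≡ length (filter Q? xs) → filter P? xs ≡ filter Q? xs
⊆∧length-filter-≡⇒filter-≡ P? Q? P⊆Q xs lengths-≡ =
  Pointwise-≡⇒≡ (toPointwise lengths-≡ (filter⁺ P? Q? (λ { refl → P⊆Q }) (⊆-refl {x = xs})))

module _ {P : Pred (Fin n) 0ℓ} (P? : Decidable₁ P) where

  universal⇒cardinality≡n : (∀ x → P x) → cardinality P? ≡ n
  universal⇒cardinality≡n all-P = begin
    length (filter P? (allFin n)) ≡⟨ cong length (filter-all P? (tabulate⁺ all-P)) ⟩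
    length (allFin n)             ≡⟨ length-tabulate id ⟩
    n                             ∎
    where open ≡-Reasoning

  cardinality<n⇒∃¬ : cardinality P? < n → ∃[ x ] ¬ P x
  cardinality<n⇒∃¬ card<n = ¬∀⟶∃¬ n P P? (<⇒≢ card<n ∘ universal⇒cardinality≡n)

  ⊆∧cardinality-≡⇒⊇ : {Q : Pred (Fin n) 0ℓ} (Q? : Decidable₁ Q) →
                      P ⊆ Q → cardinality P? ≡ cardinality Q? → Q ⊆ P
  ⊆∧cardinality-≡⇒⊇ Q? P⊆Q cards-≡ {x} Qx = proj₂ (∈-filter⁻ P? {xs = allFin n} x∈filter-P)
    where
    x∈filter-P : x ∈ filter P? (allFin n)
    x∈filter-P = subst (x ∈_) (sym (⊆∧length-filter-≡⇒filter-≡ P? Q? P⊆Q (allFin n) cards-≡))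
                       (∈-filter⁺ Q? (∈-allFin x) Qx)

module _ {_≺_ : Rel A ℓ} (≺-wellFounded : WellFounded _≺_)
         (below? : ∀ x → Dec (Satisfiable (_≺ x))) where

  downwardClosed⇒∃minimal : {P : Pred A p} → P Respects (flip _≺_) → Satisfiable P →
                            ∃[ m ] (P m × Empty (_≺ m))
  downwardClosed⇒∃minimal {P = P} P-downward (x , Px) = descend (≺-wellFounded x) Px
    where
    descend : ∀ {x} → Acc _≺_ x → P x → ∃[ m ] (P m × Empty (_≺ m))
    descend {x} (acc rec) Px with below? x
    ... | yes (_ , y≺x) = descend (rec y≺x) (P-downward y≺x Px)
    ... | no  none≺x    = x , Px , λ y y≺x → none≺x (y , y≺x)

pattern direct u⟶v             = inj₁ u⟶v
pattern unlinked u↮v           = inj₂ (inj₁ u↮v)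
pattern arc-arc w u⟶w w⟶v      = inj₂ (inj₂ (w , inj₁ (u⟶w , w⟶v)))
pattern arc-unlinked w u⟶w w↮v = inj₂ (inj₂ (w , inj₂ (inj₁ (u⟶w , w↮v))))
pattern unlinked-arc w u↮w w⟶v = inj₂ (inj₂ (w , inj₂ (inj₂ (u↮w , w⟶v))))

module _ (G : OrientedGraph n) where
  open OrientedGraph G

  infix 4 _Covers_ _covers?_

  record _Covers_ (u v : Fin n) : Set where
    field
      arc            : u ⟶ v
      successors-⊇   : (v ⟶_) ⊆ (u ⟶_)
      predecessors-⊆ : (_⟶ u) ⊆ (_⟶ v)

  open _Covers_

  covers-irrefl : Irreflexive _≡_ _Covers_
  covers-irrefl u≡v = irrefl u≡v ∘ arc

  covers-trans : Transitive _Covers_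
  covers-trans u-covers-v v-covers-w = record
    { arc            = successors-⊇ u-covers-v (arc v-covers-w)
    ; successors-⊇   = successors-⊇ u-covers-v ∘ successors-⊇ v-covers-w
    ; predecessors-⊆ = predecessors-⊆ v-covers-w ∘ predecessors-⊆ u-covers-v
    }

  covers-isStrictPartialOrder : IsStrictPartialOrder _≡_ _Covers_
  covers-isStrictPartialOrder = record
    { isEquivalence = isEquivalence
    ; irrefl        = covers-irrefl
    ; trans         = covers-trans
    ; <-resp-≈      = resp₂ _Covers_
    }

  covers⇒¬weaklyReachable : ∀ {u v} → u Covers v → ¬ WeaklyReachable G v u
  covers⇒¬weaklyReachable u-covers-v (direct v⟶u)                   = asym v⟶u (arc u-covers-v)
  covers⇒¬weaklyReachable u-covers-v (unlinked (_ , u↛v))           = u↛v (arc u-covers-v)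
  covers⇒¬weaklyReachable u-covers-v (arc-arc _ v⟶w w⟶u)            = asym w⟶u (successors-⊇ u-covers-v v⟶w)
  covers⇒¬weaklyReachable u-covers-v (arc-unlinked _ v⟶w (_ , u↛w)) = u↛w (successors-⊇ u-covers-v v⟶w)
  covers⇒¬weaklyReachable u-covers-v (unlinked-arc _ (_ , w↛v) w⟶u) = w↛v (predecessors-⊆ u-covers-v w⟶u)

  ¬weaklyReachable⇒covers : ∀ {u v} → ¬ WeaklyReachable G v u → u Covers v
  ¬weaklyReachable⇒covers {u} {v} unreachable = record
    { arc            = decidable-stable (u ⟶? v) λ u↛v →
                         unreachable (unlinked (unreachable ∘ direct , u↛v))
    ; successors-⊇   = λ {w} v⟶w → decidable-stable (u ⟶? w) λ u↛w →
                         unreachable (arc-unlinked w v⟶w (no-path v⟶w , u↛w))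
    ; predecessors-⊆ = λ {w} w⟶u → decidable-stable (w ⟶? v) λ w↛v →
                         unreachable (unlinked-arc w (flip no-path w⟶u , w↛v) w⟶u)
    }
    where
    no-path : ∀ {w} → v ⟶ w → ¬ (w ⟶ u)
    no-path v⟶w w⟶u = unreachable (arc-arc _ v⟶w w⟶u)

  ¬weaklyReachable⇔covers : ∀ {u v} → (¬ WeaklyReachable G v u) ⇔ u Covers v
  ¬weaklyReachable⇔covers = mk⇔ ¬weaklyReachable⇒covers covers⇒¬weaklyReachable

  _covers?_ : Decidable _Covers_
  u covers? v = map-dec ¬weaklyReachable⇔covers (¬? (weaklyReachable? G v u))

  covered⇒¬weakKing : ∀ {u v} → u Covers v → ¬ WeakKing G v
  covered⇒¬weakKing u-covers-v v-king =
    covers⇒¬weaklyReachable u-covers-v (v-king _ λ u≡v → covers-irrefl u≡v u-covers-v)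

  coversNothing⇒weakSerf : ∀ {u} → Empty (u Covers_) → WeakSerf G u
  coversNothing⇒weakSerf {u} nothing v _ =
    decidable-stable (weaklyReachable? G v u) (nothing v ∘ ¬weaklyReachable⇒covers)

  ∃¬weakKing⇒∃¬weakKing∧weakSerf : ∃[ u ] ¬ WeakKing G u → ∃[ v ] (¬ WeakKing G v × WeakSerf G v)
  ∃¬weakKing⇒∃¬weakKing∧weakSerf nonKing =
    let v , ¬king , v-covers-nothing =
          downwardClosed⇒∃minimal (spo-noetherian covers-isStrictPartialOrder)
            (λ u → any? (u covers?_)) (λ u-covers-v _ → covered⇒¬weakKing u-covers-v) nonKing
    in  v , ¬king , coversNothing⇒weakSerf v-covers-nothing

theorem8 : ∀ (n k s : ℕ) → n > k → k ≥ s → s ≥ 0 → ¬ KingSerfGraph n k s s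
theorem8 n k s n>k _ _ H =
  let ∃¬king           = cardinality<n⇒∃¬ (weakKing? graph) (subst (_< n) (sym kings) n>k)
      _ , ¬king , serf = ∃¬weakKing⇒∃¬weakKing∧weakSerf graph ∃¬king
  in  ¬king (weakSerf⇒weakKing serf)
  where
  open KingSerfGraph H

  weakSerf⇒weakKing : WeakSerf graph ⊆ WeakKing graph
  weakSerf⇒weakKing = proj₁ ∘
    ⊆∧cardinality-≡⇒⊇ (weakKing? graph ∩? weakSerf? graph) (weakSerf? graph) proj₂ (trans kingSerfs (sym serfs))
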